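{- As $t \to \infty$, $$r(K_5^{3- }, K_t^3) = 2^{O(t^2 \log t)}.$$ That is, there is a constant $C>0$ such that $r(K_5^{3- }, K_t^3) \le 2^{C t^2 \log t}$ for all sufficiently large integers $t$.
   Context: A $3$-graph (triple system) $H$ with vertex set $V(H)$ is a collection of $3$-element subsets of $V(H)$, called edges. $K_n^3$ is the complete $3$-graph on $n$ vertices (all $3$-subsets are edges). $K_5^{3- }$ is the $3$-graph obtained from $K_5^3$ by deleting one edge. For $3$-graphs $F, G$, the Ramsey number $r(F,G)$ is the minimum $n$ such that every coloring of the edges of $K_n^3$ with colors red and blue contains a copy of $F$ (as a not necessarily induced subhypergraph) all of whose edges are red, or a copy of $G$ all of whose edges are blue. -}

module Defs where

open import Data.Bool using (true; false)
open import Data.Fin using (Fin)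
open import Data.Fin.Properties using (any?; _≟_)
open import Data.Fin.Subset using (Subset; ∣_∣)
open import Data.Fin.Subset.Properties using (_∈?_)
open import Data.Nat using (ℕ; _≤_)
open import Data.Product using (Σ-syntax; _×_; proj₁)
open import Data.Sum using (_⊎_)
open import Data.Vec using (tabulate; []; _∷_)
open import Function.Definitions using (Injective)
open import Relation.Binary.PropositionalEquality using (_≡_; _≢_)
open import Relation.Nullary.Decidable using (does; _×-dec_)

record 3-Graph (n : ℕ) : Set₁ where
  field
    Edge    : Subset n → Set
    uniform : ∀ {e} → Edge e → ∣ e ∣ ≡ 3

open 3-Graph public

image : ∀ {m n} → (Fin m → Fin n) → Subset m → Subset n
image f e = tabulate (λ y → does (any? (λ x → (x ∈? e) ×-dec (f x ≟ y))))

-- G contains a copy of F, not necessarily induced.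
Contains : ∀ {m n} → 3-Graph n → 3-Graph m → Set
Contains {m} {n} G F =
  Σ[ f ∈ (Fin m → Fin n) ]
    Injective _≡_ _≡_ f × (∀ e → Edge F e → Edge G (image f e))

K³ : ∀ n → 3-Graph n
K³ n = record { Edge = λ e → ∣ e ∣ ≡ 3 ; uniform = λ p → p }

_without_ : ∀ {n} → 3-Graph n → Subset n → 3-Graph n
H without e₀ = record
  { Edge    = λ e → Edge H e × e ≢ e₀
  ; uniform = λ p → uniform H (proj₁ p)
  }

-- All choices of the deleted edge give isomorphic 3-graphs; we delete {0,1,2}.
K₅³⁻ : 3-Graph 5
K₅³⁻ = K³ 5 without (true ∷ true ∷ true ∷ false ∷ false ∷ [])

data Colour : Set where
  red blue : Colour

Colouring : ℕ → Set
Colouring n = (e : Subset n) → Edge (K³ n) e → Colour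

colourClass : ∀ {n} → Colouring n → Colour → 3-Graph n
colourClass {n} χ c = record
  { Edge    = λ e → Σ[ p ∈ Edge (K³ n) e ] χ e p ≡ c
  ; uniform = proj₁
  }

Arrows : ∀ {a b} → ℕ → 3-Graph a → 3-Graph b → Set
Arrows n F G =
  (χ : Colouring n) →
    Contains (colourClass χ red) F ⊎ Contains (colourClass χ blue) G

-- r(F , G) = n.  The Ramsey number is given by its graph, so a bound on it is
-- to be stated together with the existence of n.
IsRamseyNumber : ∀ {a b} → 3-Graph a → 3-Graph b → ℕ → Set
IsRamseyNumber F G n = Arrows n F G × (∀ m → Arrows m F G → n ≤ m)

{-# OPTIONS --safe #-}

-- Following Conlon, Fox and Sudakov, vertices are inserted one by one into a
-- binary search tree.  A new vertex v arriving at a node u descends to the red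
-- or to the blue side, and only those remaining vertices w are kept for which
-- {u, v, w} has that colour; so the colour of {u, v, w} depends on u and v only.
-- All remaining w are routed along with v and the most popular exit of the tree
-- is chosen, so an insertion divides their number by at most the number of exits.
--
-- The u's left by a blue step on the way to v form, with v and one w, a blue
-- clique.  After red steps at a and then b, a node u at which a further vertex v
-- arrives gives a red K₅³⁻ on a, b, u, v, w with only {u, v, w} missing.  Hence
-- below two red steps there is room for one vertex only, the whole tree holds
-- O(t²) vertices, and (O(t²))^O(t²) = 2^O(t² log t) vertices suffice.
module Submission where

open import Defs
import Data.Bool.Properties as Bool
open import Data.Fin as Fin using (Fin; zero; suc)
open import Data.Fin.Patterns using (0F; 1F; 2F)
import Data.Fin.Properties as Fin
open import Data.Fin.Subset as Subset using (Subset; ∣_∣; ⁅_⁆; _∪_; _∈_; _∉_; inside; outside)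
open import Data.Fin.Subset.Properties
  using ( _∈?_; anySubset?; ⊆-antisym; x∈p∪q⁺; x∈p∪q⁻; x∈⁅x⁆; x∈⁅y⁆⇒x≡y; ∣⁅x⁆∣≡1
        ; ∪-identityˡ; ∪-identityʳ)
open import Data.List using (List; []; _∷_; length; filter; lookup; allFin)
open import Data.List.Properties using (length-tabulate)
open import Data.List.Membership.Propositional.Properties using (∈-lookup)
open import Data.List.Relation.Binary.Subset.Propositional using (_⊆_)
open import Data.List.Relation.Binary.Subset.Propositional.Properties
  using (filter-⊆; ∷⁺ʳ; xs⊆x∷xs; ⊆-trans)
open import Data.List.Relation.Unary.All as All using (All; []; _∷_)
open import Data.List.Relation.Unary.All.Properties using (anti-mono; all-filter)
open import Data.List.Relation.Unary.AllPairs using (_∷_)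
open import Data.List.Relation.Unary.Unique.Propositional using (Unique)
open import Data.List.Relation.Unary.Unique.Propositional.Properties using (allFin⁺; filter⁺)
open import Data.Nat
  using (ℕ; zero; suc; _+_; _*_; _^_; _≤_; _<_; z≤n; s≤s; s≤s⁻¹; NonZero; >-nonZero)
open import Data.Nat.Logarithm using (⌊log₂_⌋; ⌊log₂⌋-mono-≤; ⌊log₂[2^n]⌋≡n)
open import Data.Nat.Properties
open import Data.Nat.Tactic.RingSolver using (solve-∀)
open import Data.Product using (∃; ∃-syntax; _×_; _,_; proj₁; proj₂; map₂)
open import Data.Sum as Sum using (_⊎_; inj₁; inj₂)
open import Data.Unit using (⊤; tt)
open import Data.Vec using ([]; _∷_; here; there)
import Data.Vec.Properties as Vec
open import Function using (_∘_; id)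
open import Function.Definitions using (Injective)
open import Relation.Binary.Definitions using (tri<; tri≈; tri>; DecidableEquality)
open import Relation.Binary.PropositionalEquality
open import Relation.Nullary using (Dec; yes; no; contradiction)
open import Relation.Nullary.Decidable
  using (dec-true; map′; ¬?; _×-dec_; _⊎-dec_; _→-dec_; decidable-stable)
open import Relation.Unary using (Decidable)

_≟ᶜ_ : DecidableEquality Colour
red  ≟ᶜ red  = yes refl
red  ≟ᶜ blue = no λ ()
blue ≟ᶜ red  = no λ ()
blue ≟ᶜ blue = yes refl

≢red⇒≡blue : ∀ {c} → c ≢ red → c ≡ blue
≢red⇒≡blue {red}  c≢red = contradiction refl c≢red
≢red⇒≡blue {blue} _     = refl

-- Triples as subsets, and images

triple : ∀ {n} → Fin n → Fin n → Fin n → Subset n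
triple x y z = ⁅ x ⁆ ∪ (⁅ y ⁆ ∪ ⁅ z ⁆)

∣⁅x⁆∪p∣≡1+∣p∣ : ∀ {n} {x : Fin n} {p} → x ∉ p → ∣ ⁅ x ⁆ ∪ p ∣ ≡ suc ∣ p ∣
∣⁅x⁆∪p∣≡1+∣p∣ {x = zero}  {inside  ∷ p} x∉p = contradiction here x∉p
∣⁅x⁆∪p∣≡1+∣p∣ {x = zero}  {outside ∷ p} x∉p = cong (suc ∘ ∣_∣) (∪-identityˡ p)
∣⁅x⁆∪p∣≡1+∣p∣ {x = suc x} {inside  ∷ p} x∉p = cong suc (∣⁅x⁆∪p∣≡1+∣p∣ (x∉p ∘ there))
∣⁅x⁆∪p∣≡1+∣p∣ {x = suc x} {outside ∷ p} x∉p = ∣⁅x⁆∪p∣≡1+∣p∣ (x∉p ∘ there)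

∣triple∣≡3 : ∀ {n} {x y z : Fin n} → x ≢ y → x ≢ z → y ≢ z → ∣ triple x y z ∣ ≡ 3
∣triple∣≡3 {x = x} {y} {z} x≢y x≢z y≢z = begin
  ∣ triple x y z ∣        ≡⟨ ∣⁅x⁆∪p∣≡1+∣p∣
                               (Sum.[ x≢y ∘ x∈⁅y⁆⇒x≡y y , x≢z ∘ x∈⁅y⁆⇒x≡y z ] ∘ x∈p∪q⁻ _ _) ⟩
  suc ∣ ⁅ y ⁆ ∪ ⁅ z ⁆ ∣   ≡⟨ cong suc (∣⁅x⁆∪p∣≡1+∣p∣ (y≢z ∘ x∈⁅y⁆⇒x≡y z)) ⟩
  suc (suc ∣ ⁅ z ⁆ ∣)     ≡⟨ cong (2 +_) (∣⁅x⁆∣≡1 z) ⟩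
  3                       ∎
  where open ≡-Reasoning

∣p∣≡0⇒p≡⊥ : ∀ {n} (p : Subset n) → ∣ p ∣ ≡ 0 → p ≡ Subset.⊥
∣p∣≡0⇒p≡⊥ []            _   = refl
∣p∣≡0⇒p≡⊥ (outside ∷ p) p≡0 = cong (outside ∷_) (∣p∣≡0⇒p≡⊥ p p≡0)

extract-min : ∀ {n k} (p : Subset n) → ∣ p ∣ ≡ suc k →
  ∃[ x ] ∃[ q ] p ≡ ⁅ x ⁆ ∪ q × ∣ q ∣ ≡ k × (∀ {y} → y ∈ q → x Fin.< y)
extract-min (inside ∷ p) ∣p∣≡ =
  zero , outside ∷ p , cong (inside ∷_) (sym (∪-identityˡ p)) , suc-injective ∣p∣≡
       , λ { (there _) → s≤s z≤n }
extract-min (outside ∷ p) ∣p∣≡ with x , q , p≡ , ∣q∣≡ , x<q ← extract-min p ∣p∣≡ =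
  suc x , outside ∷ q , cong (outside ∷_) p≡ , ∣q∣≡ , λ { (there y∈q) → s≤s (x<q y∈q) }

∣p∣≡3⇒triple : ∀ {n} (p : Subset n) → ∣ p ∣ ≡ 3 →
  ∃[ i ] ∃[ j ] ∃[ k ] i Fin.< j × j Fin.< k × p ≡ triple i j k
∣p∣≡3⇒triple p ∣p∣≡3
  with i , q , refl , ∣q∣≡2 , i<q ← extract-min p ∣p∣≡3
  with j , r , refl , ∣r∣≡1 , j<r ← extract-min q ∣q∣≡2
  with k , s , refl , ∣s∣≡0 , _   ← extract-min r ∣r∣≡1
  with refl ← ∣p∣≡0⇒p≡⊥ s ∣s∣≡0 =
  i , j , k
    , i<q (x∈p∪q⁺ (inj₁ (x∈⁅x⁆ j)))
    , j<r (x∈p∪q⁺ (inj₁ (x∈⁅x⁆ k)))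
    , cong (λ r → ⁅ i ⁆ ∪ (⁅ j ⁆ ∪ r)) (∪-identityʳ ⁅ k ⁆)

module _ {m n} (f : Fin m → Fin n) where

  ∈-image⁺ : ∀ {x e} → x ∈ e → f x ∈ image f e
  ∈-image⁺ {x} {e} x∈e =
    Vec.lookup⇒[]= (f x) (image f e)
      (trans (Vec.lookup∘tabulate _ (f x)) (dec-true (Fin.any? _) (x , x∈e , refl)))

  ∈-image⁻ : ∀ {y e} → y ∈ image f e → ∃[ x ] x ∈ e × f x ≡ y
  ∈-image⁻ {y} {e} y∈ with Fin.any? (λ x → (x ∈? e) ×-dec (f x Fin.≟ y)) in eq
  ... | yes found = found
  ... | no  _     = contradiction
    (trans (sym (trans (Vec.lookup∘tabulate _ y) (cong Dec.does eq))) (Vec.[]=⇒lookup y∈)) λ ()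

  image-⁅⁆ : ∀ x → image f ⁅ x ⁆ ≡ ⁅ f x ⁆
  image-⁅⁆ x = ⊆-antisym to from
    where
    to : image f ⁅ x ⁆ Subset.⊆ ⁅ f x ⁆
    to y∈ with z , z∈ , refl ← ∈-image⁻ y∈ with refl ← x∈⁅y⁆⇒x≡y x z∈ = x∈⁅x⁆ _

    from : ⁅ f x ⁆ Subset.⊆ image f ⁅ x ⁆
    from y∈ with refl ← x∈⁅y⁆⇒x≡y (f x) y∈ = ∈-image⁺ (x∈⁅x⁆ x)

  image-∪ : ∀ p q → image f (p ∪ q) ≡ image f p ∪ image f q
  image-∪ p q = ⊆-antisym to from
    where
    to : image f (p ∪ q) Subset.⊆ image f p ∪ image f q
    to y∈ with z , z∈ , refl ← ∈-image⁻ y∈ = x∈p∪q⁺ (Sum.map ∈-image⁺ ∈-image⁺ (x∈p∪q⁻ p q z∈))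

    from : image f p ∪ image f q Subset.⊆ image f (p ∪ q)
    from y∈ with x∈p∪q⁻ (image f p) _ y∈
    ... | inj₁ y∈ with z , z∈ , refl ← ∈-image⁻ y∈ = ∈-image⁺ (x∈p∪q⁺ (inj₁ z∈))
    ... | inj₂ y∈ with z , z∈ , refl ← ∈-image⁻ y∈ = ∈-image⁺ (x∈p∪q⁺ (inj₂ z∈))

  image-triple : ∀ x y z → image f (triple x y z) ≡ triple (f x) (f y) (f z)
  image-triple x y z =
    trans (image-∪ _ _)
      (cong₂ _∪_ (image-⁅⁆ x) (trans (image-∪ _ _) (cong₂ _∪_ (image-⁅⁆ y) (image-⁅⁆ z))))

image-cong : ∀ {m n} {f g : Fin m → Fin n} → f ≗ g → ∀ e → image f e ≡ image g e
image-cong {f = f} {g} f≗g e = ⊆-antisym (to f≗g) (to (sym ∘ f≗g))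
  where
  to : ∀ {f g} → f ≗ g → image f e Subset.⊆ image g e
  to {f} {g} f≗g y∈ with z , z∈ , refl ← ∈-image⁻ f y∈ =
    subst (_∈ image g e) (sym (f≗g z)) (∈-image⁺ g z∈)

-- Colourings that ignore the proof that an edge has three elements

untyped : ∀ {n} → (Subset n → Colour) → Colouring n
untyped χ e _ = χ e

-- Every edge lists its vertices in increasing order in exactly one way, so checking `i < j < k`
-- covers all edges.
contains-triples : ∀ {m n} (F : 3-Graph m) (χ : Subset n → Colour) c (f : Fin m → Fin n) →
  (∀ {i j} → i Fin.< j → f i ≢ f j) →
  (∀ {i j k} → i Fin.< j → j Fin.< k → Edge F (triple i j k) → χ (triple (f i) (f j) (f k)) ≡ c) →
  Contains (colourClass (untyped χ) c) F
contains-triples F χ c f distinct coloured = f , injective , edges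
  where
  injective : Injective _≡_ _≡_ f
  injective {i} {j} fi≡fj with Fin.<-cmp i j
  ... | tri< i<j _ _ = contradiction fi≡fj (distinct i<j)
  ... | tri≈ _ i≡j _ = i≡j
  ... | tri> _ _ j<i = contradiction (sym fi≡fj) (distinct j<i)

  edges : ∀ e → Edge F e → Edge (colourClass (untyped χ) c) (image f e)
  edges e e∈F with i , j , k , i<j , j<k , refl ← ∣p∣≡3⇒triple e (uniform F e∈F)
    rewrite image-triple f i j k =
    ∣triple∣≡3 (distinct i<j) (distinct (Fin.<-trans i<j j<k)) (distinct j<k) , coloured i<j j<k e∈F

contains-transport : ∀ {m n} {F : 3-Graph m} {χ χ′ : Colouring n} {c} →
  (∀ e p → χ e p ≡ χ′ e p) → Contains (colourClass χ c) F → Contains (colourClass χ′ c) F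
contains-transport χ≗χ′ (f , f-inj , edges) =
  f , f-inj , λ e e∈F → map₂ (trans (sym (χ≗χ′ _ _))) (edges e e∈F)

Arrowsᵘ : ∀ {a b} → ℕ → 3-Graph a → 3-Graph b → Set
Arrowsᵘ n F G = (χ : Subset n → Colour) →
  Contains (colourClass (untyped χ) red) F ⊎ Contains (colourClass (untyped χ) blue) G

-- Proofs of `∣ e ∣ ≡ 3` are unique, so a colouring amounts to its values on three-element subsets.
arrowsᵘ⇒arrows : ∀ {a b n} {F : 3-Graph a} {G : 3-Graph b} → Arrowsᵘ n F G → Arrows n F G
arrowsᵘ⇒arrows {n = n} {F} {G} arrows χ =
  Sum.map (contains-transport {F = F} agrees) (contains-transport {F = G} agrees) (arrows χᵘ)
  where
  χᵘ : Subset n → Colour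
  χᵘ e with ∣ e ∣ ≟ 3
  ... | yes p = χ e p
  -- An arbitrary default: sets of other sizes are in no colour class.
  ... | no  _ = red

  agrees : ∀ e p → χᵘ e ≡ χ e p
  agrees e p with ∣ e ∣ ≟ 3
  ... | yes q   = cong (χ e) (≡-irrelevant q p)
  ... | no  e≢3 = contradiction p e≢3

-- Decidability of the arrow relation, without function extensionality

-- Exhaustive search meets a function only up to pointwise equality, so the predicate must respect
-- it.
Extensional : ∀ {A B : Set} → ((A → B) → Set) → Set
Extensional P = ∀ {f g} → f ≗ g → P f → P g

anyFunction? : ∀ {m n} {P : (Fin m → Fin n) → Set} → Extensional P → Decidable P → Dec (∃ P)
anyFunction? {zero}  ext P? = map′ (_ ,_) (λ (_ , Pf) → ext (λ ()) Pf) (P? λ ())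
anyFunction? {suc m} {n} {P} ext P? =
  map′ (λ (x , f , Pf) → cons x f , Pf)
       (λ (f , Pf) → f zero , f ∘ suc , ext (λ { zero → refl ; (suc _) → refl }) Pf)
       (Fin.any? λ x → anyFunction?
         (λ f≗g → ext λ { zero → refl ; (suc i) → f≗g i }) (λ f → P? (cons x f)))
  where
  cons : Fin n → (Fin m → Fin n) → Fin (suc m) → Fin n
  cons x f zero    = x
  cons x f (suc i) = f i

anyColour? : ∀ {P : Colour → Set} → Decidable P → Dec (∃ P)
anyColour? P? =
  map′ Sum.[ (red ,_) , (blue ,_) ] (λ { (red , p) → inj₁ p ; (blue , p) → inj₂ p })
       (P? red ⊎-dec P? blue)

-- A colouring for `suc n` is a pair of colourings for `n`, on the sets with and without `zero`; the
-- searches for the two are nested.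
anySubsetColouring? : ∀ {n} {P : (Subset n → Colour) → Set} →
  Extensional P → Decidable P → Dec (∃ P)
anySubsetColouring? {zero} ext P? =
  map′ (λ (c , p) → (λ _ → c) , p)
       (λ (χ , p) → χ [] , ext (λ { [] → refl }) p)
       (anyColour? λ c → P? λ _ → c)
anySubsetColouring? {suc n} ext P? =
  map′ (λ (χ , χ′ , p) → join χ χ′ , p)
       (λ (χ , p) → χ ∘ (inside ∷_) , χ ∘ (outside ∷_)
                  , ext (λ { (inside ∷ _) → refl ; (outside ∷ _) → refl }) p)
       (anySubsetColouring?
         (λ f≗g → map₂ (ext λ { (inside ∷ e) → f≗g e ; (outside ∷ _) → refl }))
         λ χ → anySubsetColouring?
           (λ f≗g → ext λ { (inside ∷ _) → refl ; (outside ∷ e) → f≗g e })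
           λ χ′ → P? (join χ χ′))
  where
  join : (Subset n → Colour) → (Subset n → Colour) → Subset (suc n) → Colour
  join χ χ′ (inside  ∷ e) = χ e
  join χ χ′ (outside ∷ e) = χ′ e

allSubsets? : ∀ {n} {P : Subset n → Set} → Decidable P → Dec (∀ e → P e)
allSubsets? P? =
  map′ (λ none e → decidable-stable (P? e) λ ¬Pe → none (e , ¬Pe))
       (λ all (e , ¬Pe) → ¬Pe (all e))
       (¬? (anySubset? (¬? ∘ P?)))

injective? : ∀ {m n} (f : Fin m → Fin n) → Dec (Injective _≡_ _≡_ f)
injective? f =
  map′ (λ inj {x} {y} → inj x y) (λ inj x y → inj)
       (Fin.all? λ x → Fin.all? λ y → (f x Fin.≟ f y) →-dec (x Fin.≟ y))

contains? : ∀ {m n} {G : 3-Graph n} {F : 3-Graph m} →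
  Decidable (Edge G) → Decidable (Edge F) → Dec (Contains G F)
contains? {G = G} G? F? = anyFunction?
  (λ f≗g (inj , edges) →
    (λ gx≡gy → inj (trans (f≗g _) (trans gx≡gy (sym (f≗g _))))) ,
    (λ e e∈F → subst (Edge G) (image-cong f≗g e) (edges e e∈F)))
  (λ f → injective? f ×-dec allSubsets? λ e → F? e →-dec G? (image f e))

arrows? : ∀ {a b} {F : 3-Graph a} {G : 3-Graph b} →
  Decidable (Edge F) → Decidable (Edge G) → ∀ n → Dec (Arrows n F G)
arrows? {F = F} {G} F? G? n =
  map′ (λ none → arrowsᵘ⇒arrows {F = F} {G} λ χ →
         decidable-stable (contains₂? χ) λ ¬c → none (χ , ¬c))
       (λ arrows (χ , ¬c) → ¬c (arrows (untyped χ)))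
       (¬? (anySubsetColouring?
         (λ χ≗χ′ ¬c → ¬c ∘ Sum.map (contains-transport {F = F} (λ e _ → sym (χ≗χ′ e)))
                                   (contains-transport {F = G} (λ e _ → sym (χ≗χ′ e))))
         (¬? ∘ contains₂?)))
  where
  contains₂? : ∀ χ → Dec (Contains (colourClass (untyped {n} χ) red) F ⊎
                          Contains (colourClass (untyped χ) blue) G)
  contains₂? χ =
    contains? {G = colourClass (untyped χ) red}  {F = F} (edge? red)  F? ⊎-dec
    contains? {G = colourClass (untyped χ) blue} {F = G} (edge? blue) G?
    where
    edge? : ∀ c → Decidable (Edge (colourClass (untyped χ) c))
    edge? c e = (∣ e ∣ ≟ 3) ×-dec (χ e ≟ᶜ c)

-- Existence of the Ramsey number

least : ∀ {P : ℕ → Set} → Decidable P → ∀ {n} → P n →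
  ∃[ m ] (P m × (∀ k → P k → m ≤ k)) × m ≤ n
least P? {zero}  p = zero , (p , λ _ _ → z≤n) , z≤n
least {P} P? {suc n} p with P? zero
... | yes p₀ = zero , (p₀ , λ _ _ → z≤n) , z≤n
... | no ¬p₀ with m , (pm , min) , m≤n ← least (P? ∘ suc) p =
  suc m , (pm , λ { zero p₀ → contradiction p₀ ¬p₀ ; (suc k) pk → s≤s (min k pk) }) , s≤s m≤n

ramsey-exists-≤ : ∀ {a b} {F : 3-Graph a} {G : 3-Graph b} →
  Decidable (Edge F) → Decidable (Edge G) → ∀ {N} → Arrows N F G →
  ∃[ n ] IsRamseyNumber F G n × n ≤ N
ramsey-exists-≤ {F = F} {G} F? G? = least (arrows? {F = F} {G} F? G?)

-- Monochromatic sequences, latest vertex first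

module _ {V : Set} (col : V → V → V → Colour) where

  -- `col` is read in list order only, which becomes increasing order of positions in
  -- `contains-triples`.
  Fits : Colour → V → List V → Set
  Fits c w []       = ⊤
  Fits c w (u ∷ us) = w ≢ u × All (λ a → col w u a ≡ c) us × Fits c w us

  Mono : Colour → List V → Set
  Mono c []       = ⊤
  Mono c (w ∷ us) = Fits c w us × Mono c us

  fits-distinct : ∀ {c w us} → Fits c w us → ∀ i → w ≢ lookup us i
  fits-distinct {us = _ ∷ _} (w≢u , _ , _) zero    = w≢u
  fits-distinct {us = _ ∷ _} (_ , _ , fits) (suc i) = fits-distinct fits i

  mono-distinct : ∀ {c us} → Mono c us → ∀ {i j} → i Fin.< j → lookup us i ≢ lookup us j
  mono-distinct {us = _ ∷ _} (fits , _) {zero}  {suc j} _         = fits-distinct fits j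
  mono-distinct {us = _ ∷ _} (_ , mono) {suc i} {suc j} (s≤s i<j) = mono-distinct mono i<j

  fits-coloured : ∀ {c w us} → Fits c w us →
    ∀ {i j} → i Fin.< j → col w (lookup us i) (lookup us j) ≡ c
  fits-coloured {us = _ ∷ us} (_ , cs , _) {zero} {suc j} _ = All.lookup cs (∈-lookup j)
  fits-coloured {us = _ ∷ _} (_ , _ , fits) {suc i} {suc j} (s≤s i<j) = fits-coloured fits i<j

  mono-coloured : ∀ {c us} → Mono c us → ∀ {i j k} → i Fin.< j → j Fin.< k →
    col (lookup us i) (lookup us j) (lookup us k) ≡ c
  mono-coloured {us = _ ∷ _} (fits , _) {zero} {suc j} {suc k} _ (s≤s j<k) = fits-coloured fits j<k
  mono-coloured {us = _ ∷ _} (_ , mono) {suc i} {suc j} {suc k} (s≤s i<j) (s≤s j<k) =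
    mono-coloured mono i<j j<k

  -- A triple other than `{w, v, u}` misses one of these three vertices and so lies in one of the
  -- three given lists.
  mono-extend : ∀ {c w v u us} → Mono c (v ∷ u ∷ us) → Mono c (w ∷ u ∷ us) → Mono c (w ∷ v ∷ us) →
    col w v u ≡ c → Mono c (w ∷ v ∷ u ∷ us)
  mono-extend vu (wu , _) ((w≢v , wv , _) , _) wvu = (w≢v , wvu ∷ wv , wu) , vu

  -- Three red cliques on four vertices, each missing one of `w`, `v`, `u`; together they cover
  -- every triple but `{w, v, u}`.
  data RedK₅³⁻ : Set where
    red-K₅³⁻ : ∀ {w v u b a} →
      Mono red (v ∷ u ∷ b ∷ a ∷ []) → Mono red (w ∷ u ∷ b ∷ a ∷ []) → Mono red (w ∷ v ∷ b ∷ a ∷ []) →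
      RedK₅³⁻

  BlueClique : ℕ → Set
  BlueClique t = ∃[ us ] length us ≡ t × Mono blue us

-- Search trees and their capacity

-- r red and b blue descents are still allowed at the root of a Tree V r b.  The
-- left subtree of a node is entered by a red descent, the right one by a blue.
data Tree (V : Set) : ℕ → ℕ → Set where
  empty : ∀ {r b} → Tree V r b
  full  : ∀ {b} → V → Tree V 0 (suc b)
  node  : ∀ {r b} → V → Tree V r (suc b) → Tree V (suc r) b → Tree V (suc r) (suc b)

-- The most vertices a `Tree V r b` can hold. A binary tree has one exit more than nodes, so
-- `suc (capacity r b)` bounds its exits.
capacity : ℕ → ℕ → ℕ
capacity r       zero    = 0
capacity zero    (suc b) = 1
capacity (suc r) (suc b) = suc (capacity r (suc b) + capacity (suc r) b)

free : ∀ {V r b} → Tree V r b → ℕ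
free {r = r} {b} empty = capacity r b
free (full _)          = 0
free (node _ l r)      = free l + free r

m+n≤o+p⇒m≤o⊎n≤p : ∀ {m n} o p → m + n ≤ o + p → m ≤ o ⊎ n ≤ p
m+n≤o+p⇒m≤o⊎n≤p {m} {n} o p le with m ≤? o | n ≤? p
... | yes m≤o | _       = inj₁ m≤o
... | no  _   | yes n≤p = inj₂ n≤p
... | no  m≰o | no n≰p  = contradiction le (<⇒≱ (+-mono-< (≰⇒> m≰o) (≰⇒> n≰p)))

length-filter-∁ : ∀ {A : Set} {P : A → Set} (P? : Decidable P) xs →
  length xs ≡ length (filter P? xs) + length (filter (¬? ∘ P?) xs)
length-filter-∁ P? []       = refl
length-filter-∁ P? (x ∷ xs) with P? x
... | yes _ = cong suc (length-filter-∁ P? xs)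
... | no  _ = trans (cong suc (length-filter-∁ P? xs)) (sym (+-suc _ _))

-- Inserting a vertex

module _ {V : Set} (col : V → V → V → Colour) (t : ℕ) where

  Joins : List V → List V → V → V → Set
  Joins R B v w = Mono col red (w ∷ v ∷ R) × Mono col blue (w ∷ v ∷ B)

  -- S is the set of vertices not yet inserted; R and B are the ancestors of the
  -- tree at which its path from the root made a red or a blue descent.
  Valid : ∀ {r b} → List V → List V → List V → Tree V r b → Set
  Valid S R B empty        = ⊤
  Valid S R B (full u)     = All (λ w → Mono col red (w ∷ u ∷ R)) S
  Valid S R B (node u l r) = All (Joins R B u) S × Valid S (u ∷ R) B l × Valid S R (u ∷ B) r

  valid-antimono : ∀ {r b R B S S′} (T : Tree V r b) → S′ ⊆ S → Valid S R B T → Valid S′ R B T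
  valid-antimono empty        S′⊆S _               = tt
  valid-antimono (full u)     S′⊆S fits            = anti-mono S′⊆S fits
  valid-antimono (node u l r) S′⊆S (fits , vl , vr) =
    anti-mono S′⊆S fits , valid-antimono l S′⊆S vl , valid-antimono r S′⊆S vr

  Win : Set
  Win = RedK₅³⁻ col ⊎ BlueClique col t

  record Inserted {r b} (S R B : List V) (k : ℕ) (T : Tree V r b) : Set where
    constructor inserted
    field
      {S′}   : List V
      S′⊆S   : S′ ⊆ S
      unique : Unique S′
      k≤∣S′∣ : k ≤ length S′
      T′     : Tree V r b
      free≡  : free T ≡ suc (free T′)
      valid  : Valid S′ R B T′

  -- Descents made and descents left add up to 2 for red and `t` minus 2 for blue. The last bound
  -- reserves `k` remaining vertices for each possible exit, and `0 < k` provides the `w` that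
  -- completes a winning configuration.
  insert : ∀ {r b} (T : Tree V r b) {R B S v k} →
    r + length R ≡ 2 → b + (2 + length B) ≡ t →
    Valid (v ∷ S) R B T → All (Joins R B v) S → Unique S →
    0 < k → suc (capacity r b) * k ≤ length S →
    Win ⊎ Inserted S R B k T
  insert {b = zero} empty {S = []} {k = suc k} _ _ _ _ _ _ ()
  -- No blue descent is left, so `B` lacks just two vertices of a blue clique of size `t`.
  insert {b = zero} empty {B = B} {S = w ∷ S} {v} _ ∣B∣≡ _ ((_ , blue-wv) ∷ _) _ _ _ =
    inj₁ (inj₂ (w ∷ v ∷ B , ∣B∣≡ , blue-wv))
  insert {zero} {suc b} empty {v = v} {k} _ _ _ fits uniq _ le =
    inj₂ (inserted id uniq (≤-trans (m≤m+n k _) le) (full v) refl (All.map proj₁ fits))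
  insert {suc r} {suc b} empty {v = v} {k} _ _ _ fits uniq _ le =
    inj₂ (inserted id uniq (≤-trans (m≤m+n k _) le) (node v empty empty) refl (fits , tt , tt))
  insert (full u) {R = b ∷ a ∷ []} {S = []} {k = suc k} _ _ _ _ _ _ ()
  -- Both red descents are used up; whatever the colour of `{u, v, w}`, the other nine triples are
  -- red.
  insert (full u) {R = b ∷ a ∷ []} {S = w ∷ S} _ _ (vu ∷ wu ∷ _) ((wv , _) ∷ _) _ _ _ =
    inj₁ (inj₁ (red-K₅³⁻ vu wu wv))
  insert (node {r} {b} u T₁ T₂) {R} {B} {S} {v} {k} ∣R∣≡ ∣B∣≡
         (vu ∷ su , valid₁ , valid₂) sv uniq 0<k le =
    Sum.[ descend-red , descend-blue ] (m+n≤o+p⇒m≤o⊎n≤p (length Sᵣ) (length Sᵦ) split)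
    where
    Red? : Decidable λ w → col w v u ≡ red
    Red? w = col w v u ≟ᶜ red

    Blue? : Decidable λ w → col w v u ≢ red
    Blue? = ¬? ∘ Red?

    Sᵣ Sᵦ : List V
    Sᵣ = filter Red? S
    Sᵦ = filter Blue? S

    -- The exit bounds of the two subtrees add up to that of the node, so one colour class is large
    -- enough for its side.
    split : suc (capacity r (suc b)) * k + suc (capacity (suc r) b) * k ≤ length Sᵣ + length Sᵦ
    split = begin
      suc c₁ * k + suc c₂ * k     ≡⟨ *-distribʳ-+ k (suc c₁) (suc c₂) ⟨
      (suc c₁ + suc c₂) * k       ≡⟨ cong (λ n → suc n * k) (+-suc c₁ c₂) ⟩
      suc (suc (c₁ + c₂)) * k     ≤⟨ le ⟩
      length S                    ≡⟨ length-filter-∁ Red? S ⟩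
      length Sᵣ + length Sᵦ       ∎
      where
      open ≤-Reasoning
      c₁ c₂ : ℕ
      c₁ = capacity r (suc b)
      c₂ = capacity (suc r) b

    joinsᵣ : All (Joins (u ∷ R) B v) Sᵣ
    joinsᵣ = All.map
      (λ (wvu , (wu , _) , (wv , wv′)) → mono-extend col (proj₁ vu) wu wv wvu , wv′)
      (All.zip (all-filter Red? S , All.zip
        (anti-mono (filter-⊆ Red? S) su , anti-mono (filter-⊆ Red? S) sv)))

    joinsᵦ : All (Joins R (u ∷ B) v) Sᵦ
    joinsᵦ = All.map
      (λ (wvu , (_ , wu) , (wv , wv′)) → wv , mono-extend col (proj₂ vu) wu wv′ (≢red⇒≡blue wvu))
      (All.zip (all-filter Blue? S , All.zip
        (anti-mono (filter-⊆ Blue? S) su , anti-mono (filter-⊆ Blue? S) sv)))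

    descend-red : suc (capacity r (suc b)) * k ≤ length Sᵣ → Win ⊎ Inserted S R B k (node u T₁ T₂)
    descend-red le₁ = Sum.map₂
      (λ (inserted S′⊆ uniq′ k≤ T′ free≡ valid) →
        let S′⊆S = ⊆-trans S′⊆ (filter-⊆ Red? S) in
        inserted S′⊆S uniq′ k≤ (node u T′ T₂) (cong (_+ free T₂) free≡)
          (anti-mono S′⊆S su , valid , valid-antimono T₂ (⊆-trans S′⊆S (xs⊆x∷xs S v)) valid₂))
      (insert T₁ (trans (+-suc r _) ∣R∣≡) ∣B∣≡
        (valid-antimono T₁ (∷⁺ʳ v (filter-⊆ Red? S)) valid₁) joinsᵣ (filter⁺ Red? uniq) 0<k le₁)

    descend-blue : suc (capacity (suc r) b) * k ≤ length Sᵦ → Win ⊎ Inserted S R B k (node u T₁ T₂)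
    descend-blue le₂ = Sum.map₂
      (λ (inserted S′⊆ uniq′ k≤ T′ free≡ valid) →
        let S′⊆S = ⊆-trans S′⊆ (filter-⊆ Blue? S) in
        inserted S′⊆S uniq′ k≤ (node u T₁ T′) (trans (cong (free T₁ +_) free≡) (+-suc _ _))
          (anti-mono S′⊆S su , valid-antimono T₁ (⊆-trans S′⊆S (xs⊆x∷xs S v)) valid₁ , valid))
      (insert T₂ ∣R∣≡ (trans (+-suc b _) ∣B∣≡)
        (valid-antimono T₂ (∷⁺ʳ v (filter-⊆ Blue? S)) valid₂) joinsᵦ (filter⁺ Blue? uniq) 0<k le₂)

  -- Filling the tree

  module _ {b K : ℕ} (b≡ : b + 2 ≡ t) (cap<K : suc (suc (capacity 2 b)) ≤ K) where

    0<K^ : ∀ n → 0 < K ^ n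
    0<K^ n = m^n>0 K n
      where instance
        K≢0 : NonZero K
        K≢0 = >-nonZero (≤-trans (s≤s z≤n) cap<K)

    -- Each insertion takes one free place and keeps at least `K ^ n` vertices. The exponent is
    -- `suc n` because a tree with no free place still needs one more insertion, which must win.
    grow : ∀ n {S} (T : Tree V 2 b) → free T ≡ n → Valid S [] [] T → Unique S →
      K ^ suc n ≤ length S → Win
    grow n {[]} T free≡ valid uniq le = contradiction le (<⇒≱ (0<K^ (suc n)))
    grow n {v ∷ S} T free≡ valid (v∉S ∷ uniq) le
      with insert T refl b≡ valid
             -- On empty paths `Joins` only asks that `v` and `w` differ.
             (All.map (λ v≢w → let w≢v = λ w≡v → v≢w (sym w≡v) in
               ((w≢v , [] , tt) , tt , tt) , ((w≢v , [] , tt) , tt , tt)) v∉S)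
             uniq (0<K^ n) room
      where
      -- `K` exceeds the exit bound by at least one; the spare `K ^ n` pays for `v` itself.
      room : suc (capacity 2 b) * K ^ n ≤ length S
      room = s≤s⁻¹ (begin
        1 + suc (capacity 2 b) * K ^ n       ≤⟨ +-monoˡ-≤ _ (0<K^ n) ⟩
        suc (suc (capacity 2 b)) * K ^ n     ≤⟨ *-monoˡ-≤ (K ^ n) cap<K ⟩
        K ^ suc n                            ≤⟨ le ⟩
        suc (length S)                       ∎)
        where open ≤-Reasoning
    grow n _ _ _ _ _ | inj₁ win = win
    grow zero T free≡ _ _ _ | inj₂ (inserted _ _ _ T′ eq _) = contradiction (trans (sym eq) free≡) λ ()
    grow (suc n) T free≡ _ _ _ | inj₂ (inserted _ uniq′ le′ T′ eq valid′) =
      grow n T′ (suc-injective (trans (sym eq) free≡)) valid′ uniq′ le′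

-- Closed forms of the capacity

capacity₁ : ∀ b → capacity 1 b ≡ 2 * b
capacity₁ zero    = refl
capacity₁ (suc b) = trans (cong (2 +_) (capacity₁ b)) (sym (*-suc 2 b))

capacity₂ : ∀ b → capacity 2 b ≡ b * (b + 2)
capacity₂ zero    = refl
capacity₂ (suc b) =
  trans (cong suc (cong₂ _+_ (capacity₁ (suc b)) (capacity₂ b))) (rearrange b)
  where
  rearrange : ∀ b → suc (2 * suc b + b * (b + 2)) ≡ suc b * (suc b + 2)
  rearrange = solve-∀

-- From monochromatic sequences to copies

module _ {n} (χ : Subset n → Colour) where

  colour : Fin n → Fin n → Fin n → Colour
  colour x y z = χ (triple x y z)

  blue-clique⇒contains : ∀ {t} → BlueClique colour t → Contains (colourClass (untyped χ) blue) (K³ t)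
  blue-clique⇒contains (us , refl , mono) =
    contains-triples (K³ (length us)) χ blue (lookup us)
      (mono-distinct colour mono) (λ i<j j<k _ → mono-coloured colour mono i<j j<k)

  red-K₅³⁻⇒contains : RedK₅³⁻ colour → Contains (colourClass (untyped χ) red) K₅³⁻
  red-K₅³⁻⇒contains (red-K₅³⁻ {w} {v} {u} {b} {a} vuba (w-uba , _) (w-vba@(w≢v , _) , _)) =
    contains-triples K₅³⁻ χ red (lookup us) distinct coloured
    where
    us : List (Fin n)
    -- This order puts the missing triple `{w, v, u}` at positions 0, 1, 2, the edge deleted in
    -- `K₅³⁻`.
    us = w ∷ v ∷ u ∷ b ∷ a ∷ []

    distinct : ∀ {i j} → i Fin.< j → lookup us i ≢ lookup us j
    distinct {suc i} {suc j}       (s≤s i<j) = mono-distinct colour vuba i<j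
    distinct {zero}  {1F}          _         = w≢v
    distinct {zero}  {suc (suc j)} _         = fits-distinct colour w-uba j

    coloured : ∀ {i j k} → i Fin.< j → j Fin.< k → Edge K₅³⁻ (triple i j k) →
      χ (triple (lookup us i) (lookup us j) (lookup us k)) ≡ red
    coloured {suc i} {suc j} {suc k} (s≤s i<j) (s≤s j<k) _ = mono-coloured colour vuba i<j j<k
    coloured {zero} {1F} {1F} _ (s≤s ()) _
    coloured {zero} {1F} {2F} _ _ (_ , ≢e₀) = contradiction refl ≢e₀
    coloured {zero} {1F} {suc (suc (suc k))} _ _ _ =
      fits-coloured colour w-vba {0F} {suc k} (s≤s z≤n)
    coloured {zero} {suc (suc j)} {1F} _ (s≤s ()) _
    coloured {zero} {suc (suc j)} {suc (suc k)} _ (s≤s (s≤s j<k)) _ =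
      fits-coloured colour w-uba j<k

-- The tree starts empty with all `N` vertices waiting. Only `b` blue descents are allowed, as `v`
-- and `w` supply the last two vertices of the clique.
arrows-K₅³⁻ : ∀ {b K N} → suc (suc (capacity 2 b)) ≤ K → K ^ suc (capacity 2 b) ≤ N →
  Arrows N K₅³⁻ (K³ (2 + b))
arrows-K₅³⁻ {b} {K} {N} cap<K K^≤N = arrowsᵘ⇒arrows {F = K₅³⁻} {G = K³ (2 + b)} λ χ →
  Sum.map (red-K₅³⁻⇒contains χ) (blue-clique⇒contains χ)
    (grow (colour χ) (2 + b) (+-comm b 2) cap<K (capacity 2 b) empty refl tt (allFin⁺ N)
      (subst (K ^ suc (capacity 2 b) ≤_) (sym (length-tabulate {n = N} id)) K^≤N))

-- Logarithmic estimates and the final bound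

n<2^[1+⌊log₂n⌋] : ∀ n → n < 2 ^ suc ⌊log₂ n ⌋
n<2^[1+⌊log₂n⌋] n with n <? 2 ^ suc ⌊log₂ n ⌋
... | yes n<  = n<
... | no  n≮  = contradiction
  (subst (_≤ ⌊log₂ n ⌋) (⌊log₂[2^n]⌋≡n (suc ⌊log₂ n ⌋)) (⌊log₂⌋-mono-≤ (≮⇒≥ n≮))) (<⇒≱ ≤-refl)

-- With `l = ⌊log₂ t⌋`, `t` is below `2 ^ (l + 1)`, and `2 ≤ t` gives `1 ≤ l`, hence
-- `2 * (l + 1) ≤ 4 * l`.
t^2≤2^[4*log₂t] : ∀ {t} → 2 ≤ t → t ^ 2 ≤ 2 ^ (4 * ⌊log₂ t ⌋)
t^2≤2^[4*log₂t] {t} 2≤t = begin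
  t ^ 2                         ≤⟨ ^-monoˡ-≤ 2 (<⇒≤ (n<2^[1+⌊log₂n⌋] t)) ⟩
  (2 ^ suc ⌊log₂ t ⌋) ^ 2       ≡⟨ ^-*-assoc 2 (suc ⌊log₂ t ⌋) 2 ⟩
  2 ^ (suc ⌊log₂ t ⌋ * 2)       ≤⟨ ^-monoʳ-≤ 2 (*-monoˡ-≤ 2 (+-monoˡ-≤ ⌊log₂ t ⌋ (⌊log₂⌋-mono-≤ 2≤t))) ⟩
  2 ^ ((⌊log₂ t ⌋ + ⌊log₂ t ⌋) * 2)   ≡⟨ cong (2 ^_) (rearrange ⌊log₂ t ⌋) ⟩
  2 ^ (4 * ⌊log₂ t ⌋)           ∎
  where
  open ≤-Reasoning
  rearrange : ∀ l → (l + l) * 2 ≡ 4 * l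
  rearrange = solve-∀

-- Used twice with `t = 2 + b`: for the base `K t` and for the exponent.
2+capacity₂≤t^2 : ∀ b → 2 + capacity 2 b ≤ (2 + b) ^ 2
2+capacity₂≤t^2 b = begin
  2 + capacity 2 b              ≡⟨ cong (2 +_) (capacity₂ b) ⟩
  2 + b * (b + 2)               ≤⟨ m≤m+n _ _ ⟩
  2 + b * (b + 2) + (2 * b + 2) ≡⟨ rearrange b ⟩
  (2 + b) * ((2 + b) * 1)       ∎
  where
  open ≤-Reasoning
  rearrange : ∀ b → 2 + b * (b + 2) + (2 * b + 2) ≡ (2 + b) * ((2 + b) * 1)
  rearrange = solve-∀

K₅³⁻-edge? : Decidable (Edge K₅³⁻)
K₅³⁻-edge? e = (∣ e ∣ ≟ 3) ×-dec ¬? (Vec.≡-dec Bool._≟_ e _)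

mainTheorem2 : ∃[ C ] 0 < C × (∃[ T ] ((t : ℕ) → T ≤ t →
    ∃[ n ] IsRamseyNumber K₅³⁻ (K³ t) n × n ≤ 2 ^ (C * t ^ 2 * ⌊log₂ t ⌋)))
-- The 4 is the exponent factor in `t^2≤2^[4*log₂t]`, which needs `2 ≤ t`.
mainTheorem2 = 4 , s≤s z≤n , 2 , bound
  where
  K : ℕ → ℕ
  K t = 2 ^ (4 * ⌊log₂ t ⌋)

  K^t^2 : ∀ t → K t ^ (t ^ 2) ≡ 2 ^ (4 * t ^ 2 * ⌊log₂ t ⌋)
  K^t^2 t = trans (^-*-assoc 2 (4 * ⌊log₂ t ⌋) (t ^ 2)) (cong (2 ^_) (rearrange ⌊log₂ t ⌋ (t ^ 2)))
    where
    rearrange : ∀ l s → 4 * l * s ≡ 4 * s * l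
    rearrange = solve-∀

  bound : ∀ t → 2 ≤ t → ∃[ n ] IsRamseyNumber K₅³⁻ (K³ t) n × n ≤ 2 ^ (4 * t ^ 2 * ⌊log₂ t ⌋)
  bound t 2≤t with b , refl ← m≤n⇒∃[o]m+o≡n 2≤t =
    ramsey-exists-≤ {F = K₅³⁻} {K³ t} K₅³⁻-edge? (λ e → ∣ e ∣ ≟ 3)
      (arrows-K₅³⁻ {b} {K t} (≤-trans (2+capacity₂≤t^2 b) (t^2≤2^[4*log₂t] 2≤t)) (begin
        K t ^ suc (capacity 2 b)          ≤⟨ ^-monoʳ-≤ (K t) (≤-trans (n≤1+n _) (2+capacity₂≤t^2 b)) ⟩
        K t ^ (t ^ 2)                     ≡⟨ K^t^2 t ⟩
        2 ^ (4 * t ^ 2 * ⌊log₂ t ⌋)       ∎))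
    where
    open ≤-Reasoning
    instance
      K≢0 : NonZero (K t)
      K≢0 = m^n≢0 2 (4 * ⌊log₂ t ⌋)
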